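{- For all integers $p\ge1$ and $\ell\ge1$ there is a constant $c$, depending only on $p$ and $\ell$, such that for any $p$ request sequences to items of a list of length $\ell$ and any two merges $M_1$ and $M_2$ of these $p$ sequences, $$d(M_1)\le(2p^2-p)\,d(M_2)+c.$$
   Context: A request sequence $I=I_1,\dots,I_n$ is a finite sequence of items from a fixed set (list) of $\ell$ items; items may be repeated. For an index $j$, $\mathrm{prev}^I(j)$ is the largest index $j'<j$ with $I_{j'}=I_j$, if it exists. The distance of the $j$th request in $I$ is $$d^I(j)=\bigl|\{I_{\mathrm{prev}^I(j)},\dots,I_j\}\bigr|$$ (the number of distinct items among the requests from index $\mathrm{prev}^I(j)$ to index $j$) if $\mathrm{prev}^I(j)$ exists, and $d^I(j)=\ell$ otherwise. The total distance of $I$ is $d(I)=\sum_{j=1}^{|I|}d^I(j)$. A merge of $p$ request sequences is an interleaving of all their requests (using each request exactly once) that respects the order of each sequence. -}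

module Defs where

open import Data.Fin.Base as Fin using (Fin; toℕ)
import Data.Fin.Properties as Fin
open import Data.Fin.Subset using (⁅_⁆; ⋃; ∣_∣)
open import Data.List.Base
  using (List; []; _∷_; allFin; drop; filter; last; length; lookup; map; take)
open import Data.Maybe.Base using (Maybe; maybe′)
open import Data.Nat.Base using (ℕ; suc)
open import Data.Nat.ListAction using (sum)
open import Data.Vec.Base as Vec using (Vec; _[_]≔_)
open import Relation.Binary.PropositionalEquality.Core using (_≡_)
open import Relation.Nullary.Decidable.Core using (_×-dec_)

Requests : ℕ → Set
Requests ℓ = List (Fin ℓ)

module _ {ℓ : ℕ} (I : Requests ℓ) where

  -- `allFin` is increasing, so `last` selects the largest suitable index.
  prev : Fin (length I) → Maybe (Fin (length I))
  prev j = last (filter (λ j′ → (j′ Fin.<? j) ×-dec (lookup I j′ Fin.≟ lookup I j))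
                        (allFin (length I)))

  -- The requests with indices from j′ to j, both ends included.
  segment : (j′ j : Fin (length I)) → Requests ℓ
  segment j′ j = drop (toℕ j′) (take (suc (toℕ j)) I)

  distance : Fin (length I) → ℕ
  distance j = maybe′ (λ j′ → ∣ ⋃ (map ⁅_⁆ (segment j′ j)) ∣) ℓ (prev j)

  totalDistance : ℕ
  totalDistance = sum (map distance (allFin (length I)))

-- p-ary analogue of Data.List.Relation.Ternary.Interleaving: each step moves
-- the first remaining request of some sequence to the merge.
data Merge {a} {A : Set a} {p : ℕ} : Vec (List A) p → List A → Set a where
  done : ∀ {ss} → (∀ i → Vec.lookup ss i ≡ []) → Merge ss []
  step : ∀ {ss x xs m} (i : Fin p) → Vec.lookup ss i ≡ x ∷ xs →
         Merge (ss [ i ]≔ xs) m → Merge ss (x ∷ m)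

{-# OPTIONS --safe #-}
-- Up to an additive constant, the distance of a request to x is the number of items y
-- (x included) requested since the previous request to x, so the total distance is the
-- sum over pairs (x, y) of the number of requests to x with a request to y since the
-- previous one.  Each such count is monotone under passing to subsequences, so every
-- sequence costs at most d(M₂).
--
-- For M₁, distinguish copies of an item by the sequence they come from.  Pairs from one
-- sequence cost at most d(M₂).  For two sequences s and t, consider a request to x in s
-- and an item y of t requested since the previous x of s.  Let A and B be the numbers of
-- items of s and of t at least as recent as y.  If B ≤ A, charge the pair to the request
-- to x: B takes distinct values and A is at most the distance of x in s.  If A < B,
-- the potential ∑ min(A, B) over the items y of t rises; it drops by at most the distance
-- of y in t when y is requested.  Hence s against t costs at most d(s) + d(t) + O(1),
-- for a total factor of p + 2p(p − 1) = 2p² − p.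
module Submission where

open import Defs
open import Data.Bool.Base using (true; false; if_then_else_)
open import Data.Fin.Base as Fin using (Fin; zero; suc; punchIn; toℕ)
import Data.Fin.Properties as Fin
open import Data.Fin.Subset using (Subset; ⁅_⁆; ⋃; ∣_∣)
import Data.Fin.Subset as Subset using (_∈_; _∉_; _∪_)
import Data.Fin.Subset.Properties as Subset
open import Data.List.Base
  using (List; []; _∷_; _++_; _ʳ++_; allFin; filter; last; length; lookup; map; tabulate; take)
open import Data.List.Membership.Propositional using (_∈_; _∉_)
open import Data.List.Membership.Propositional.Properties
  using (∈-++⁻; ∈-++⁺ˡ; ∈-allFin; ∈-filter⁺; ∈-filter⁻)
open import Data.List.Properties using (++-ʳ++; map-tabulate; tabulate-cong; take-suc)
open import Data.List.Relation.Binary.Sublist.Propositional using (_⊆_; []; _∷_; _∷ʳ_)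
open import Data.List.Relation.Unary.All as All using (All; []; _∷_)
open import Data.List.Relation.Unary.AllPairs using (AllPairs; []; _∷_)
import Data.List.Relation.Unary.AllPairs.Properties as AllPairs
open import Data.List.Relation.Unary.Any using (here; there)
open import Data.List.Relation.Unary.Any.Properties using (reverseAcc⁺; reverse⁻)
open import Data.Maybe.Base using (just; nothing)
open import Data.Nat.Base using (ℕ; zero; suc; _+_; _*_; _∸_; _^_; _≤_; z≤n; s≤s; z<s; s<s; _⊓_)
import Data.Nat.ListAction as List using (sum)
open import Data.Nat.Properties renaming (_≟_ to _≟ℕ_)
open import Data.Nat.Tactic.RingSolver using (solve-∀)
open import Data.Product.Base using (∃-syntax; _×_; _,_; proj₁; proj₂) renaming (map₂ to map₂′)
open import Data.Product.Properties using (≡-dec; ,-injectiveˡ; ,-injectiveʳ)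
open import Data.Sum.Base using (_⊎_; inj₁; inj₂; map₂)
open import Data.Vec.Base as Vec using (Vec) renaming ([] to []ᵛ; _∷_ to _∷ᵛ_)
open import Data.Vec.Properties using (lookup∘update; lookup∘update′)
open import Function.Base using (_∘_; id)
open import Relation.Binary.Definitions using (DecidableEquality)
open import Relation.Binary.PropositionalEquality
  using (_≡_; _≢_; refl; sym; trans; cong; cong₂; subst; module ≡-Reasoning)
open import Relation.Nullary.Decidable.Core using (Dec; yes; no; does; _×-dec_)
open import Relation.Nullary.Negation.Core using (¬_; contradiction)

-- Finite sums of natural numbers

open import Algebra.Properties.CommutativeMonoid.Sum +-0-commutativeMonoid

∑-mono : ∀ {n} {f g : Fin n → ℕ} → (∀ i → f i ≤ g i) → ∑[ i < n ] f i ≤ ∑[ i < n ] g i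
∑-mono {zero}  f≤g = z≤n
∑-mono {suc n} f≤g = +-mono-≤ (f≤g zero) (∑-mono (f≤g ∘ suc))

∑-const : ∀ n c → ∑[ _ < n ] c ≡ n * c
∑-const zero    c = refl
∑-const (suc n) c = cong (c +_) (∑-const n c)

term≤∑ : ∀ {n} (f : Fin n → ℕ) i → f i ≤ ∑[ j < n ] f j
term≤∑ f zero    = m≤m+n _ _
term≤∑ f (suc i) = ≤-trans (term≤∑ (f ∘ suc) i) (m≤n+m _ _)

∑-single : ∀ {n} (f : Fin n → ℕ) i → (∀ j → j ≢ i → f j ≡ 0) → ∑[ j < n ] f j ≡ f i
∑-single {suc n} f i f≡0 = begin
  ∑[ j < suc n ] f j                        ≡⟨ sum-remove {i = i} f ⟩
  f i + ∑[ j < n ] f (punchIn i j)      ≡⟨ cong (f i +_) (sum-cong-≗ (λ j → f≡0 _ (Fin.punchInᵢ≢i i j))) ⟩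
  f i + ∑[ j < n ] 0                        ≡⟨ cong (f i +_) (sum-replicate-zero n) ⟩
  f i + 0                                   ≡⟨ +-identityʳ (f i) ⟩
  f i                                       ∎
  where open ≡-Reasoning

∑-indicator : ∀ {n} (i : Fin n) c → ∑[ j < n ] (if does (j Fin.≟ i) then c else 0) ≡ c
∑-indicator {n} i c = trans (∑-single δ i δ-off) δ-on
  where
  δ : Fin n → ℕ
  δ j = if does (j Fin.≟ i) then c else 0
  δ-on : δ i ≡ c
  δ-on with i Fin.≟ i
  ... | yes _ = refl
  ... | no i≢i = contradiction refl i≢i
  δ-off : ∀ j → j ≢ i → δ j ≡ 0
  δ-off j j≢i with j Fin.≟ i
  ... | yes j≡i = contradiction j≡i j≢i
  ... | no  _ = refl

-- Recency and charges in a history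

-- Histories list the most recent request first.
module Recency {A : Set} (_≟_ : DecidableEquality A) where

  -- 1 if v = u or v was requested after the last request to u (possibly with no
  -- request to u at all), and 0 otherwise.
  recent : A → A → List A → ℕ
  recent u v []      = if does (u ≟ v) then 1 else 0
  recent u v (w ∷ h) = if does (w ≟ v) then 1 else if does (w ≟ u) then 0 else recent u v h

  charge : A → A → List A → ℕ
  charge u v []      = 0
  charge u v (w ∷ h) = (if does (w ≟ u) then recent u v h else 0) + charge u v h

  recent-hit : ∀ u v h → recent u v (v ∷ h) ≡ 1
  recent-hit u v h with v ≟ v
  ... | yes _ = refl
  ... | no v≢v = contradiction refl v≢v

  recent-[] : ∀ {u v} → u ≢ v → recent u v [] ≡ 0
  recent-[] {u} {v} u≢v with u ≟ v
  ... | yes u≡v = contradiction u≡v u≢v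
  ... | no  _ = refl

  recent-stop : ∀ {u v} h → u ≢ v → recent u v (u ∷ h) ≡ 0
  recent-stop {u} {v} h u≢v with u ≟ v
  ... | yes u≡v = contradiction u≡v u≢v
  ... | no  _ with u ≟ u
  ...   | yes _ = refl
  ...   | no u≢u = contradiction refl u≢u

  recent-skip : ∀ {u v w} h → w ≢ u → w ≢ v → recent u v (w ∷ h) ≡ recent u v h
  recent-skip {u} {v} {w} h w≢u w≢v with w ≟ v
  ... | yes w≡v = contradiction w≡v w≢v
  ... | no  _ with w ≟ u
  ...   | yes w≡u = contradiction w≡u w≢u
  ...   | no  _ = refl

  charge-hit : ∀ u v h → charge u v (u ∷ h) ≡ recent u v h + charge u v h
  charge-hit u v h with u ≟ u
  ... | yes _ = refl
  ... | no u≢u = contradiction refl u≢u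

  charge-miss : ∀ {u w} v h → w ≢ u → charge u v (w ∷ h) ≡ charge u v h
  charge-miss {u} {w} v h w≢u with w ≟ u
  ... | yes w≡u = contradiction w≡u w≢u
  ... | no  _ = refl

  recent≤1 : ∀ u v h → recent u v h ≤ 1
  recent≤1 u v [] with u ≟ v
  ... | yes _ = ≤-refl
  ... | no  _ = z≤n
  recent≤1 u v (w ∷ h) with w ≟ v | w ≟ u
  ... | yes _ | _     = ≤-refl
  ... | no  _ | yes _ = z≤n
  ... | no  _ | no  _ = recent≤1 u v h

  recent-refl : ∀ u h → recent u u h ≡ 1
  recent-refl u [] with u ≟ u
  ... | yes _ = refl
  ... | no u≢u = contradiction refl u≢u
  recent-refl u (w ∷ h) with w ≟ u
  ... | yes _ = refl
  ... | no  _ = recent-refl u h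

  recent-cons : ∀ {u w} v h → w ≢ u → recent u v h ≤ recent u v (w ∷ h)
  recent-cons {u} {w} v h w≢u with w ≟ v
  ... | yes _ = recent≤1 u v h
  ... | no  _ with w ≟ u
  ...   | yes w≡u = contradiction w≡u w≢u
  ...   | no  _ = ≤-refl

  -- Read `recent u v h ≡ 1` as an order in which distinct unrequested items are incomparable.
  -- Unless `u ≡ v`, the hypothesis says that a scan back in time meets `v` before any `u`, so
  -- whatever it meets before `v` also comes before `u`.
  recent-trans : ∀ u v t h → recent u v h ≡ 1 → recent v t h ≤ recent u t h
  recent-trans u v t [] r with u ≟ v
  recent-trans u .u t [] r | yes refl = ≤-refl
  recent-trans u v t [] () | no _
  recent-trans u v t (w ∷ h) r with w ≟ t
  ... | yes _ = ≤-refl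
  ... | no  _ with w ≟ v
  ...   | yes _ = z≤n
  ...   | no  _ with w ≟ u
  recent-trans u v t (w ∷ h) () | no _ | no _ | yes _
  ...     | no  _ = recent-trans u v t h r

  recent-antisym : ∀ u v h → u ≢ v → recent u v h ≡ 1 → recent v u h ≡ 0
  recent-antisym u v [] u≢v r with u ≟ v
  ... | yes u≡v = contradiction u≡v u≢v
  recent-antisym u v [] u≢v () | no _
  recent-antisym u v (w ∷ h) u≢v r with w ≟ v
  recent-antisym u v (w ∷ h) u≢v r | yes refl with w ≟ u
  ... | yes w≡u = contradiction (sym w≡u) u≢v
  ... | no  _   = refl
  recent-antisym u v (w ∷ h) u≢v r | no _ with w ≟ u
  recent-antisym u v (w ∷ h) u≢v () | no _ | yes _
  ... | no _ = recent-antisym u v h u≢v r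

  -- Totality fails for two unrequested items. Above a common `u` it holds, because only requested
  -- items lie strictly above anything.
  recent-total : ∀ u v t h → recent u v h ≡ 1 → recent u t h ≡ 1 →
                 recent v t h ≡ 1 ⊎ recent t v h ≡ 1
  recent-total u v t [] r s with u ≟ v | u ≟ t
  recent-total u .u t [] r s | yes refl | yes refl = inj₁ (recent-refl u [])
  recent-total u v t [] () s | no _ | _
  recent-total u v t [] r () | yes _ | no _
  recent-total u v t (w ∷ h) r s with w ≟ v | w ≟ t
  ... | yes _ | yes _ = inj₁ refl
  ... | yes _ | no  _ = inj₂ refl
  ... | no  _ | yes _ = inj₁ refl
  ... | no  _ | no  _ with w ≟ u
  recent-total u v t (w ∷ h) () s | no _ | no _ | yes _
  ...   | no  _ = recent-total u v t h r s

  -- `m` is a block in chronological order, put on top of the past `h` by `ʳ++`. Without a request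
  -- to `u` in it, the block cannot demote `v`.
  recent-keep : ∀ {u} v m h → u ∉ m → recent u v h ≡ 1 → recent u v (m ʳ++ h) ≡ 1
  recent-keep v []      h u∉m r = r
  recent-keep {u} v (w ∷ m) h u∉m r = recent-keep v m (w ∷ h) (u∉m ∘ there)
    (≤-antisym (recent≤1 u v (w ∷ h))
      (≤-trans (≤-reflexive (sym r)) (recent-cons v h (u∉m ∘ here ∘ sym))))

  recent-inside : ∀ {u v} m h → u ∉ m → v ∈ m → recent u v (m ʳ++ h) ≡ 1
  recent-inside {u} {v} (w ∷ m) h u∉m (here refl) =
    recent-keep v m (v ∷ h) (u∉m ∘ there) (recent-hit u v h)
  recent-inside (w ∷ m) h u∉m (there v∈m) = recent-inside m (w ∷ h) (u∉m ∘ there) v∈m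

  recent-outside : ∀ {u v} m h → u ∉ m → v ∉ m → recent u v (m ʳ++ h) ≡ recent u v h
  recent-outside []      h u∉m v∉m = refl
  recent-outside (w ∷ m) h u∉m v∉m =
    trans (recent-outside m (w ∷ h) (u∉m ∘ there) (v∉m ∘ there))
          (recent-skip h (u∉m ∘ here ∘ sym) (v∉m ∘ here ∘ sym))

  -- charge u v h is the number of disjoint occurrences of v … u, so it can only
  -- drop when requests are deleted; recent u v h records a pending v.
  charge-⊆ : ∀ u v {h h′} → h ⊆ h′ →
             charge u v h ≤ charge u v h′ ×
             recent u v h + charge u v h ≤ recent u v h′ + charge u v h′
  charge-⊆ u v [] = ≤-refl , ≤-refl
  charge-⊆ u v {h} {w ∷ h′} (.w ∷ʳ h⊆h′) with charge-⊆ u v h⊆h′ | w ≟ v | w ≟ u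
  ... | c , rc | yes _ | yes _ = ≤-trans c (m≤n+m _ _) , ≤-trans rc (m≤n+m _ 1)
  ... | c , rc | yes _ | no  _ = c , +-mono-≤ (recent≤1 u v h) c
  ... | c , rc | no  _ | yes _ = ≤-trans c (m≤n+m _ _) , rc
  ... | c , rc | no  _ | no  _ = c , rc
  charge-⊆ u v {w ∷ h} {w ∷ h′} (refl ∷ h⊆h′) with charge-⊆ u v h⊆h′ | w ≟ v | w ≟ u
  ... | c , rc | yes _ | yes _ = rc , s≤s rc
  ... | c , rc | yes _ | no  _ = c , s≤s c
  ... | c , rc | no  _ | yes _ = rc , rc
  ... | c , rc | no  _ | no  _ = c , rc

  -- Recency ranks within a family of items

  module _ {n} (f : Fin n → A) where

    -- The recency rank of `u` among the items `f x`; `u` may lie outside the family, as it does for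
    -- the rank A of an item of t among those of s.
    reach : A → List A → ℕ
    reach u h = ∑[ x < n ] recent u (f x) h

    reach-cons : ∀ {u w} h → w ≢ u → reach u h ≤ reach u (w ∷ h)
    reach-cons h w≢u = ∑-mono (λ x → recent-cons (f x) h w≢u)

    reach-trans : ∀ u v h → recent u v h ≡ 1 → reach v h ≤ reach u h
    reach-trans u v h r = ∑-mono (λ x → recent-trans u v (f x) h r)

    reach≤ : ∀ u h → reach u h ≤ n
    reach≤ u h = ≤-trans (∑-mono (λ x → recent≤1 u (f x) h))
                   (≤-reflexive (trans (∑-const n 1) (*-identityʳ n)))

    -- `f x` overtakes `u` and joins the count, while a request to an item other than `u` makes
    -- nothing fall behind `u`.
    reach-suc : ∀ {x u} h → f x ≢ u → recent u (f x) h ≡ 0 → suc (reach u h) ≤ reach u (f x ∷ h)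
    reach-suc {x} {u} h fx≢u r≡0 = begin
      1 + reach u h
        ≡⟨ cong (_+ reach u h) (∑-indicator x 1) ⟨
      ∑[ y < n ] δ y + reach u h
        ≡⟨ ∑-distrib-+ δ _ ⟨
      ∑[ y < n ] (δ y + recent u (f y) h)
        ≤⟨ ∑-mono pointwise ⟩
      reach u (f x ∷ h) ∎
      where
      open ≤-Reasoning
      δ : Fin n → ℕ
      δ y = if does (y Fin.≟ x) then 1 else 0
      pointwise : ∀ y → δ y + recent u (f y) h ≤ recent u (f y) (f x ∷ h)
      pointwise y with y Fin.≟ x
      ... | yes refl = ≤-reflexive (trans (cong suc r≡0) (sym (recent-hit u (f x) h)))
      ... | no _ = recent-cons (f y) h fx≢u

  -- e is the indicator of a set of requests more recent than u; unless the set
  -- is empty, it has a least recent element.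
  oldest : ∀ {n} (f : Fin n → A) u h (e : Fin n → ℕ) →
           (∀ x → e x ≡ 0 ⊎ e x ≡ 1 × recent u (f x) h ≡ 1) →
           (∀ x → e x ≡ 0) ⊎ ∃[ x ] (e x ≡ 1 × ∀ y → e y ≤ recent (f x) (f y) h)
  oldest {zero}  f u h e spec = inj₁ λ ()
  oldest {suc n} f u h e spec with oldest (f ∘ suc) u h (e ∘ suc) (spec ∘ suc) | spec zero
  ... | inj₁ empty | inj₁ e₀≡0 = inj₁ λ { zero → e₀≡0 ; (suc x) → empty x }
  ... | inj₁ empty | inj₂ (e₀≡1 , _) = inj₂ (zero , e₀≡1 , λ
    { zero    → ≤-reflexive (trans e₀≡1 (sym (recent-refl _ h)))
    ; (suc y) → ≤-trans (≤-reflexive (empty y)) z≤n })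
  ... | inj₂ (x , ex≡1 , old) | inj₁ e₀≡0 = inj₂ (suc x , ex≡1 , λ
    { zero    → ≤-trans (≤-reflexive e₀≡0) z≤n
    ; (suc y) → old y })
  ... | inj₂ (x , ex≡1 , old) | inj₂ (e₀≡1 , r₀) with spec (suc x)
  ...   | inj₁ ex≡0 = contradiction (trans (sym ex≡0) ex≡1) λ ()
  ...   | inj₂ (_ , rx) with recent-total u (f zero) (f (suc x)) h r₀ rx
  ...     | inj₁ r = inj₂ (zero , e₀≡1 , λ
    { zero    → ≤-reflexive (trans e₀≡1 (sym (recent-refl _ h)))
    ; (suc y) → ≤-trans (old y) (recent-trans _ _ _ h r) })
  ...     | inj₂ r = inj₂ (suc x , ex≡1 , λ
    { zero    → ≤-reflexive (trans e₀≡1 (sym r))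
    ; (suc y) → old y })

  -- Charges between two families of items

  traffic : ∀ {m n} → (Fin m → A) → (Fin n → A) → List A → ℕ
  traffic {m} {n} f g h = ∑[ x < m ] ∑[ y < n ] charge (f x) (g y) h

  module _ {m n} (f : Fin m → A) (g : Fin n → A) where

    traffic-miss : ∀ {w} h → (∀ x → w ≢ f x) → traffic f g (w ∷ h) ≡ traffic f g h
    traffic-miss h w≢f = sum-cong-≗ (λ x → sum-cong-≗ (λ y → charge-miss (g y) h (w≢f x)))

    -- By injectivity the request touches only row `x`, where each `g y` contributes its `recent`
    -- value.
    traffic-hit : (∀ {x y} → f x ≡ f y → x ≡ y) → ∀ x h →
                  traffic f g (f x ∷ h) ≡ reach g (f x) h + traffic f g h
    traffic-hit f-inj x h = begin
      ∑[ z < m ] ∑[ y < n ] (hit z y + charge (f z) (g y) h)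
        ≡⟨ sum-cong-≗ (λ z → ∑-distrib-+ (hit z) _) ⟩
      ∑[ z < m ] (∑[ y < n ] hit z y + ∑[ y < n ] charge (f z) (g y) h)
        ≡⟨ ∑-distrib-+ (λ z → ∑[ y < n ] hit z y) _ ⟩
      ∑[ z < m ] ∑[ y < n ] hit z y + traffic f g h
        ≡⟨ cong (_+ traffic f g h) (∑-single _ x (λ z z≢x →
             trans (sum-cong-≗ (hit-off z z≢x)) (sum-replicate-zero n))) ⟩
      ∑[ y < n ] hit x y + traffic f g h
        ≡⟨ cong (_+ traffic f g h) (sum-cong-≗ hit-on) ⟩
      reach g (f x) h + traffic f g h ∎
      where
      open ≡-Reasoning
      hit : Fin m → Fin n → ℕ
      hit z y = if does (f x ≟ f z) then recent (f z) (g y) h else 0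
      hit-off : ∀ z → z ≢ x → ∀ y → hit z y ≡ 0
      hit-off z z≢x y with f x ≟ f z
      ... | yes fx≡fz = contradiction (sym (f-inj fx≡fz)) z≢x
      ... | no _ = refl
      hit-on : ∀ y → hit x y ≡ recent (f x) (g y) h
      hit-on y with f x ≟ f x
      ... | yes _ = refl
      ... | no ≢ = contradiction refl ≢

  -- The potential argument for two disjoint families

  module Crossing {m n} (f : Fin m → A) (g : Fin n → A)
    (f-inj : ∀ {x y} → f x ≡ f y → x ≡ y) (g-inj : ∀ {x y} → g x ≡ g y → x ≡ y)
    (f≢g : ∀ x y → f x ≢ g y) where

    -- One term min(A, B) of the potential, with `reach f` as A and `reach g` as B.
    slack : Fin n → List A → ℕ
    slack y h = reach f (g y) h ⊓ reach g (g y) h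

    potential : List A → ℕ
    potential h = ∑[ y < n ] slack y h

    -- Source of the additive constant of a pair of sequences: each of the `n` minima is at most A,
    -- hence at most `m`.
    potential≤ : ∀ h → potential h ≤ n * m
    potential≤ h = ≤-trans (∑-mono (λ y → ≤-trans (m⊓n≤m _ _) (reach≤ f (g y) h)))
                           (≤-reflexive (∑-const n m))

    potential-other : ∀ {w} h → (∀ y → w ≢ g y) → potential h ≤ potential (w ∷ h)
    potential-other h w≢g =
      ∑-mono (λ y → ⊓-mono-≤ (reach-cons f h (w≢g y)) (reach-cons g h (w≢g y)))

    -- Only the ranks of `g y` itself can fall, and its slack was at most B beforehand.
    potential-g : ∀ y h → potential h ≤ potential (g y ∷ h) + reach g (g y) h
    potential-g y h = begin
      potential h
        ≤⟨ ∑-mono pointwise ⟩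
      ∑[ z < n ] (slack z (g y ∷ h) + loss z)
        ≡⟨ ∑-distrib-+ (λ z → slack z (g y ∷ h)) loss ⟩
      potential (g y ∷ h) + ∑[ z < n ] loss z
        ≡⟨ cong (potential (g y ∷ h) +_) (∑-indicator y (reach g (g y) h)) ⟩
      potential (g y ∷ h) + reach g (g y) h ∎
      where
      open ≤-Reasoning
      loss : Fin n → ℕ
      loss z = if does (z Fin.≟ y) then reach g (g y) h else 0
      pointwise : ∀ z → slack z h ≤ slack z (g y ∷ h) + loss z
      pointwise z with z Fin.≟ y
      ... | yes refl = ≤-trans (m⊓n≤n _ _) (m≤n+m _ _)
      ... | no z≢y = ≤-trans
        (⊓-mono-≤ (reach-cons f h (z≢y ∘ sym ∘ g-inj)) (reach-cons g h (z≢y ∘ sym ∘ g-inj)))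
        (m≤m+n _ 0)

    -- Each `g y` charged by this request either gains slack, which pays for it, or is marked by
    -- `full`. The marked items are paid for by the rank of `f x` in its own family.
    potential-f : ∀ x h → reach g (f x) h + potential h ≤ potential (f x ∷ h) + reach f (f x) h
    potential-f x h = begin
      reach g (f x) h + potential h
        ≡⟨ ∑-distrib-+ (λ y → recent (f x) (g y) h) _ ⟨
      ∑[ y < n ] (recent (f x) (g y) h + slack y h)
        ≤⟨ ∑-mono pointwise ⟩
      ∑[ y < n ] (slack y (f x ∷ h) + full y)
        ≡⟨ ∑-distrib-+ (λ y → slack y (f x ∷ h)) full ⟩
      potential (f x ∷ h) + ∑[ y < n ] full y
        ≤⟨ +-monoʳ-≤ (potential (f x ∷ h)) full≤ ⟩
      potential (f x ∷ h) + reach f (f x) h ∎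
      where
      open ≤-Reasoning
      slack-mono : ∀ y → slack y h ≤ slack y (f x ∷ h)
      slack-mono y = ⊓-mono-≤ (reach-cons f h (f≢g x y)) (reach-cons g h (f≢g x y))
      -- `e` marks an item whose charge falls on the request itself. Recording recency and B ≤ A
      -- with the mark is what lets `oldest` bound the number of marks.
      surplus : ∀ y → ∃[ e ]
        ((e ≡ 0 ⊎ e ≡ 1 × recent (f x) (g y) h ≡ 1 × reach g (g y) h ≤ reach f (g y) h) ×
         recent (f x) (g y) h + slack y h ≤ slack y (f x ∷ h) + e)
      surplus y with recent (f x) (g y) h ≟ℕ 1
      ... | no r≢1 = 0 , inj₁ refl , (begin
        recent (f x) (g y) h + slack y h
          ≡⟨ cong (_+ slack y h) (n<1⇒n≡0 (≤∧≢⇒< (recent≤1 (f x) (g y) h) r≢1)) ⟩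
        slack y h             ≤⟨ slack-mono y ⟩
        slack y (f x ∷ h)     ≤⟨ m≤m+n _ 0 ⟩
        slack y (f x ∷ h) + 0 ∎)
      ... | yes r≡1 with reach g (g y) h ≤? reach f (g y) h
      ...   | yes B≤A = 1 , inj₂ (refl , r≡1 , B≤A) , (begin
        recent (f x) (g y) h + slack y h ≡⟨ cong (_+ slack y h) r≡1 ⟩
        1 + slack y h                    ≤⟨ +-monoʳ-≤ 1 (slack-mono y) ⟩
        1 + slack y (f x ∷ h)            ≡⟨ +-comm 1 _ ⟩
        slack y (f x ∷ h) + 1            ∎)
      -- Here the minimum is A. By antisymmetry `f x` was older than `g y`, so the request raises A
      -- by one, and A + 1 ≤ B keeps B from capping the gain.
      ...   | no B≰A = 0 , inj₁ refl , (begin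
        recent (f x) (g y) h + slack y h
          ≡⟨ cong (_+ slack y h) r≡1 ⟩
        1 + slack y h
          ≡⟨ cong suc (m≤n⇒m⊓n≡m (<⇒≤ (≰⇒> B≰A))) ⟩
        1 + reach f (g y) h
          ≤⟨ ⊓-glb (reach-suc f h (f≢g x y) (recent-antisym _ _ h (f≢g x y) r≡1))
                   (≤-trans (≰⇒> B≰A) (reach-cons g h (f≢g x y))) ⟩
        slack y (f x ∷ h)
          ≤⟨ m≤m+n _ 0 ⟩
        slack y (f x ∷ h) + 0 ∎)
      full : Fin n → ℕ
      full y = proj₁ (surplus y)
      pointwise : ∀ y → recent (f x) (g y) h + slack y h ≤ slack y (f x ∷ h) + full y
      pointwise y = proj₂ (proj₂ (surplus y))
      full≤ : ∑[ y < n ] full y ≤ reach f (f x) h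
      full≤ with oldest g (f x) h full (λ y → map₂ (map₂′ proj₁) (proj₁ (proj₂ (surplus y))))
      ... | inj₁ empty =
        ≤-trans (≤-reflexive (trans (sum-cong-≗ empty) (sum-replicate-zero n))) z≤n
      -- All marked items are at least as recent as the oldest one, so their number is at most its
      -- B, and B ≤ A for it. Since it is at least as recent as `f x`, its A is at most the rank of
      -- `f x`.
      ... | inj₂ (y , full≡1 , old) with proj₁ (proj₂ (surplus y))
      ...   | inj₁ full≡0 = contradiction (trans (sym full≡0) full≡1) λ ()
      ...   | inj₂ (_ , r≡1 , B≤A) = begin
        ∑[ z < n ] full z ≤⟨ ∑-mono old ⟩
        reach g (g y) h   ≤⟨ B≤A ⟩
        reach f (g y) h   ≤⟨ reach-trans f _ _ h r≡1 ⟩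
        reach f (f x) h   ∎

    -- Amortized induction along the history: a request to `f` is paid for by `potential-f`, one to
    -- `g` by `potential-g`, and any other changes no charge and cannot lower the potential.
    traffic≤ : ∀ h → traffic f g h ≤ potential h + (traffic f f h + traffic g g h)
    traffic≤ [] = ≤-trans (≤-reflexive (trans (sum-cong-≗ {m} (λ _ → sum-replicate-zero n))
                                              (sum-replicate-zero m))) z≤n
    traffic≤ (w ∷ h) with Fin.any? (λ x → w ≟ f x) | Fin.any? (λ y → w ≟ g y)
    ... | yes (x , refl) | _ = begin
      traffic f g (f x ∷ h)
        ≡⟨ traffic-hit f g f-inj x h ⟩
      reach g (f x) h + traffic f g h
        ≤⟨ +-monoʳ-≤ (reach g (f x) h) (traffic≤ h) ⟩
      reach g (f x) h + (potential h + (traffic f f h + traffic g g h))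
        ≡⟨ +-assoc (reach g (f x) h) _ _ ⟨
      reach g (f x) h + potential h + (traffic f f h + traffic g g h)
        ≤⟨ +-monoˡ-≤ _ (potential-f x h) ⟩
      potential (f x ∷ h) + reach f (f x) h + (traffic f f h + traffic g g h)
        ≡⟨ shuffle (potential (f x ∷ h)) (reach f (f x) h) (traffic f f h) (traffic g g h) ⟩
      potential (f x ∷ h) + (reach f (f x) h + traffic f f h + traffic g g h)
        ≡⟨ cong (potential (f x ∷ h) +_) (cong₂ _+_ (traffic-hit f f f-inj x h)
             (traffic-miss g g h (f≢g x))) ⟨
      potential (f x ∷ h) + (traffic f f (f x ∷ h) + traffic g g (f x ∷ h)) ∎
      where
      open ≤-Reasoning
      shuffle : ∀ a b c d → a + b + (c + d) ≡ a + (b + c + d)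
      shuffle = solve-∀
    ... | no w∉f | yes (y , refl) = begin
      traffic f g (g y ∷ h)
        ≡⟨ traffic-miss f g h (λ x gy≡fx → w∉f (x , gy≡fx)) ⟩
      traffic f g h
        ≤⟨ traffic≤ h ⟩
      potential h + (traffic f f h + traffic g g h)
        ≤⟨ +-monoˡ-≤ _ (potential-g y h) ⟩
      potential (g y ∷ h) + reach g (g y) h + (traffic f f h + traffic g g h)
        ≡⟨ shuffle (potential (g y ∷ h)) (reach g (g y) h) (traffic f f h) (traffic g g h) ⟩
      potential (g y ∷ h) + (traffic f f h + (reach g (g y) h + traffic g g h))
        ≡⟨ cong (potential (g y ∷ h) +_) (cong₂ _+_
             (traffic-miss f f h (λ x gy≡fx → w∉f (x , gy≡fx))) (traffic-hit g g g-inj y h)) ⟨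
      potential (g y ∷ h) + (traffic f f (g y ∷ h) + traffic g g (g y ∷ h)) ∎
      where
      open ≤-Reasoning
      shuffle : ∀ a b c d → a + b + (c + d) ≡ a + (c + (b + d))
      shuffle = solve-∀
    ... | no w∉f | no w∉g = begin
      traffic f g (w ∷ h)
        ≡⟨ traffic-miss f g h (λ x w≡ → w∉f (x , w≡)) ⟩
      traffic f g h
        ≤⟨ traffic≤ h ⟩
      potential h + (traffic f f h + traffic g g h)
        ≤⟨ +-monoˡ-≤ _ (potential-other h (λ y w≡ → w∉g (y , w≡))) ⟩
      potential (w ∷ h) + (traffic f f h + traffic g g h)
        ≡⟨ cong (potential (w ∷ h) +_) (cong₂ _+_
             (traffic-miss f f h (λ x w≡ → w∉f (x , w≡)))
             (traffic-miss g g h (λ y w≡ → w∉g (y , w≡)))) ⟨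
      potential (w ∷ h) + (traffic f f (w ∷ h) + traffic g g (w ∷ h)) ∎
      where open ≤-Reasoning

-- The distance as a function of the requested item and the reversed past

∈⋃⁺ : ∀ {n} {x : Fin n} xs → x ∈ xs → x Subset.∈ ⋃ (map ⁅_⁆ xs)
∈⋃⁺ (x ∷ xs) (here refl)  = Subset.x∈p∪q⁺ (inj₁ (Subset.x∈⁅x⁆ x))
∈⋃⁺ (_ ∷ xs) (there x∈xs) = Subset.x∈p∪q⁺ (inj₂ (∈⋃⁺ xs x∈xs))

∈⋃⁻ : ∀ {n} {x : Fin n} xs → x Subset.∈ ⋃ (map ⁅_⁆ xs) → x ∈ xs
∈⋃⁻ []       x∈ = contradiction x∈ Subset.∉⊥
∈⋃⁻ (y ∷ xs) x∈ with Subset.x∈p∪q⁻ ⁅ y ⁆ _ x∈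
... | inj₁ x∈⁅y⁆ = here (Subset.x∈⁅y⁆⇒x≡y y x∈⁅y⁆)
... | inj₂ x∈⋃   = there (∈⋃⁻ xs x∈⋃)

∣p∣≡∑ : ∀ {n} (p : Subset n) (e : Fin n → ℕ) → (∀ {y} → y Subset.∈ p → e y ≡ 1) →
        (∀ {y} → y Subset.∉ p → e y ≡ 0) → ∣ p ∣ ≡ ∑[ y < n ] e y
∣p∣≡∑ []ᵛ e e∈ e∉ = refl
∣p∣≡∑ (true ∷ᵛ p) e e∈ e∉ =
  cong₂ _+_ (sym (e∈ Vec.here)) (∣p∣≡∑ p (e ∘ suc) (e∈ ∘ Vec.there)
                                (λ y∉p → e∉ λ { (Vec.there y∈p) → y∉p y∈p }))
∣p∣≡∑ (false ∷ᵛ p) e e∈ e∉ =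
  cong₂ _+_ (sym (e∉ λ ())) (∣p∣≡∑ p (e ∘ suc) (e∈ ∘ Vec.there)
                                (λ y∉p → e∉ λ { (Vec.there y∈p) → y∉p y∈p }))

last-nothing : ∀ {A : Set} (xs : List A) → last xs ≡ nothing → xs ≡ []
last-nothing []           _  = refl
last-nothing (x ∷ y ∷ xs) eq = contradiction (last-nothing (y ∷ xs) eq) λ ()

last-∈ : ∀ {A : Set} {m : A} xs → last xs ≡ just m → m ∈ xs
last-∈ (x ∷ [])     refl = here refl
last-∈ (_ ∷ y ∷ xs) eq   = there (last-∈ (y ∷ xs) eq)

last-max : ∀ {n} {m : Fin n} xs → AllPairs Fin._<_ xs → last xs ≡ just m → All (Fin._≤ m) xs
last-max (x ∷ [])     _          refl = ≤-refl ∷ []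
last-max (_ ∷ y ∷ xs) (x< ∷ inc) eq   =
  <⇒≤ (All.lookup x< (last-∈ (y ∷ xs) eq)) ∷ last-max (y ∷ xs) inc eq

take-∈ : ∀ {A : Set} (xs : List A) (j : Fin (length xs)) {x} → x ∈ take (toℕ j) xs →
         ∃[ i ] (i Fin.< j × lookup xs i ≡ x)
take-∈ (y ∷ xs) (suc j) (here refl) = zero , z<s , refl
take-∈ (y ∷ xs) (suc j) (there x∈) with take-∈ xs j x∈
... | i , i<j , eq = suc i , s<s i<j , eq

-- The same `mid` occurs in the segment, whose items the distance counts, and in the past, which
-- `recent` scans. Its indices lie strictly between `i` and `j`, so maximality of `prev` applies to
-- them.
segment-split : ∀ {ℓ} (I : Requests ℓ) {i j : Fin (length I)} → i Fin.< j → ∃[ mid ]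
  (segment I i j ≡ lookup I i ∷ mid ++ lookup I j ∷ [] ×
   take (toℕ j) I ≡ take (toℕ i) I ++ lookup I i ∷ mid ×
   (∀ {x} → x ∈ mid → ∃[ k ] (i Fin.< k × k Fin.< j × lookup I k ≡ x)))
segment-split (y ∷ I) {zero} {suc j} _ =
  take (toℕ j) I , cong (y ∷_) (take-suc I j) , refl , later
  where
  later : ∀ {x} → x ∈ take (toℕ j) I → ∃[ k ]
    (Fin.zero {length I} Fin.< k × k Fin.< suc j × lookup (y ∷ I) k ≡ x)
  later x∈ with take-∈ I j x∈
  ... | k , k<j , eq = suc k , z<s , s<s k<j , eq
segment-split (y ∷ I) {suc i} {suc j} (s<s i<j) with segment-split I i<j
... | mid , seg , pre , between = mid , seg , cong (y ∷_) pre , λ x∈ →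
  let k , i<k , k<j , eq = between x∈ in suc k , s<s i<k , s<s k<j , eq

module _ {ℓ : ℕ} where

  open Recency (Fin._≟_ {ℓ})
  open import Data.List.Membership.DecPropositional (Fin._≟_ {ℓ}) using (_∈?_)

  -- The second branch is the value of a first request; there `reach id` would count only `x` and
  -- the items requested so far.
  cost : Fin ℓ → Requests ℓ → ℕ
  cost x h = if does (x ∈? h) then reach id x h else ℓ

  cost-seen : ∀ {x h} → x ∈ h → cost x h ≡ reach id x h
  cost-seen {x} {h} x∈h with x ∈? h
  ... | yes _ = refl
  ... | no x∉h = contradiction x∈h x∉h

  cost-unseen : ∀ {x h} → x ∉ h → cost x h ≡ ℓ
  cost-unseen {x} {h} x∉h with x ∈? h
  ... | yes x∈h = contradiction x∈h x∉h
  ... | no _ = refl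

  module _ (I : Requests ℓ) (j : Fin (length I)) where

    Earlier : Fin (length I) → Set
    Earlier i = i Fin.< j × lookup I i ≡ lookup I j

    earlier? : ∀ i → Dec (Earlier i)
    earlier? i = (i Fin.<? j) ×-dec (lookup I i Fin.≟ lookup I j)

    prev-nothing : prev I j ≡ nothing → ∀ i → ¬ Earlier i
    prev-nothing eq i e = contradiction
      (subst (i ∈_) (last-nothing _ eq) (∈-filter⁺ earlier? (∈-allFin i) e)) λ ()

    prev-just : ∀ {i} → prev I j ≡ just i → Earlier i × (∀ k → Earlier k → k Fin.≤ i)
    prev-just {i} eq =
      proj₂ (∈-filter⁻ earlier? {xs = allFin (length I)} (last-∈ _ eq)) ,
      λ k e → All.lookup (last-max _ (AllPairs.filter⁺ earlier? (AllPairs.tabulate⁺-< (λ i<j → i<j))) eq)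
                         (∈-filter⁺ earlier? (∈-allFin k) e)

    -- After the previous request to `x` comes a block `mid` free of `x`, by maximality of `prev`.
    -- So `recent x y` is 1 exactly for `x` and the items of `mid`, which are the items of the
    -- segment.
    distance≡cost : distance I j ≡ cost (lookup I j) (take (toℕ j) I ʳ++ [])
    distance≡cost with prev I j in eq
    ... | nothing = sym (cost-unseen λ x∈ →
      let i , i<j , Ii≡Ij = take-∈ I j (reverse⁻ x∈)
      in prev-nothing eq i (i<j , Ii≡Ij))
    ... | just i with prev-just eq
    ...   | (i<j , Ii≡Ij) , maximal with segment-split I i<j
    ...     | mid , seg , pre , between rewrite Ii≡Ij = begin
      ∣ ⋃ (map ⁅_⁆ (segment I i j)) ∣
        ≡⟨ cong (λ s → ∣ ⋃ (map ⁅_⁆ s) ∣) seg ⟩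
      ∣ ⋃ (map ⁅_⁆ (x ∷ mid ++ x ∷ [])) ∣
        ≡⟨ ∣p∣≡∑ _ (λ y → recent x y (mid ʳ++ past)) inside outside ⟩
      reach id x (mid ʳ++ past)
        ≡⟨ cost-seen (reverseAcc⁺ past mid (inj₁ (here refl))) ⟨
      cost x (mid ʳ++ past)
        ≡⟨ cong (cost x) (++-ʳ++ (take (toℕ i) I)) ⟨
      cost x ((take (toℕ i) I ++ x ∷ mid) ʳ++ [])
        ≡⟨ cong (λ p → cost x (p ʳ++ [])) pre ⟨
      cost x (take (toℕ j) I ʳ++ []) ∎
      where
      open ≡-Reasoning
      x = lookup I j
      past = x ∷ (take (toℕ i) I ʳ++ [])
      x∉mid : x ∉ mid
      x∉mid x∈mid = let k , i<k , k<j , Ik≡x = between x∈mid in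
        <⇒≱ i<k (maximal k (k<j , Ik≡x))
      inside : ∀ {y} → y Subset.∈ ⋃ (map ⁅_⁆ (x ∷ mid ++ x ∷ [])) → recent x y (mid ʳ++ past) ≡ 1
      inside y∈ with ∈⋃⁻ (x ∷ mid ++ x ∷ []) y∈
      ... | here refl = recent-refl x (mid ʳ++ past)
      ... | there y∈′ with ∈-++⁻ mid y∈′
      ...   | inj₁ y∈mid = recent-inside mid past x∉mid y∈mid
      ...   | inj₂ (here refl) = recent-refl x (mid ʳ++ past)
      outside : ∀ {y} → y Subset.∉ ⋃ (map ⁅_⁆ (x ∷ mid ++ x ∷ [])) → recent x y (mid ʳ++ past) ≡ 0
      outside {y} y∉ = trans
        (recent-outside mid past x∉mid (λ y∈mid → y∉ (∈⋃⁺ _ (there (∈-++⁺ˡ y∈mid)))))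
        (recent-stop {x} {y} (take (toℕ i) I ʳ++ []) (λ { refl → y∉ (∈⋃⁺ (x ∷ mid ++ x ∷ []) (here refl)) }))

  -- Total distance against the sum of all charges

  total : Requests ℓ → ℕ
  total []      = 0
  total (x ∷ h) = cost x h + total h

  -- The induction needs an arbitrary `acc`, the reversed requests already read; each step moves the
  -- cost of the head into `total`.
  sum-cost : ∀ I acc →
    List.sum (tabulate (λ j → cost (lookup I j) (take (toℕ j) I ʳ++ acc))) + total acc
    ≡ total (I ʳ++ acc)
  sum-cost []      acc = refl
  sum-cost (x ∷ I) acc =
    trans (swap (cost x acc) _ (total acc)) (sum-cost I (x ∷ acc))
    where
    swap : ∀ a b c → a + b + c ≡ b + (a + c)
    swap = solve-∀

  totalDistance≡total : ∀ I → totalDistance I ≡ total (I ʳ++ [])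
  totalDistance≡total I = begin
    List.sum (map (distance I) (allFin (length I)))
      ≡⟨ cong List.sum (map-tabulate id (distance I)) ⟩
    List.sum (tabulate (distance I))
      ≡⟨ cong List.sum (tabulate-cong (distance≡cost I)) ⟩
    List.sum (tabulate (λ j → cost (lookup I j) (take (toℕ j) I ʳ++ [])))
      ≡⟨ +-identityʳ _ ⟨
    List.sum (tabulate (λ j → cost (lookup I j) (take (toℕ j) I ʳ++ []))) + 0
      ≡⟨ sum-cost I [] ⟩
    total (I ʳ++ []) ∎
    where open ≡-Reasoning

  traffic≤total : ∀ h → traffic id id h ≤ total h
  traffic≤total [] =
    ≤-reflexive (trans (sum-cong-≗ {ℓ} (λ _ → sum-replicate-zero ℓ)) (sum-replicate-zero ℓ))
  traffic≤total (x ∷ h) = begin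
    traffic id id (x ∷ h)               ≡⟨ traffic-hit id id id x h ⟩
    reach id x h + traffic id id h      ≤⟨ +-mono-≤ reach≤cost (traffic≤total h) ⟩
    cost x h + total h                  ∎
    where
    open ≤-Reasoning
    reach≤cost : reach id x h ≤ cost x h
    reach≤cost with x ∈? h
    ... | yes _ = ≤-refl
    ... | no  _ = reach≤ id x h

  -- `cost` exceeds `reach` only at first requests, by at most `ℓ`, and each of these enlarges the
  -- set of requested items.
  total≤traffic+items : ∀ h → total h ≤ traffic id id h + ∣ ⋃ (map ⁅_⁆ h) ∣ * ℓ
  total≤traffic+items [] = z≤n
  total≤traffic+items (x ∷ h) = begin
    cost x h + total h
      ≤⟨ +-monoʳ-≤ (cost x h) (total≤traffic+items h) ⟩
    cost x h + (traffic id id h + ∣ items ∣ * ℓ)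
      ≡⟨ swap (cost x h) (traffic id id h) _ ⟩
    traffic id id h + (cost x h + ∣ items ∣ * ℓ)
      ≤⟨ +-monoʳ-≤ (traffic id id h) first ⟩
    traffic id id h + (reach id x h + ∣ ⁅ x ⁆ Subset.∪ items ∣ * ℓ)
      ≡⟨ swap′ (reach id x h) (traffic id id h) _ ⟩
    reach id x h + traffic id id h + ∣ ⁅ x ⁆ Subset.∪ items ∣ * ℓ
      ≡⟨ cong (_+ ∣ ⁅ x ⁆ Subset.∪ items ∣ * ℓ) (traffic-hit id id id x h) ⟨
    traffic id id (x ∷ h) + ∣ ⁅ x ⁆ Subset.∪ items ∣ * ℓ ∎
    where
    open ≤-Reasoning
    items = ⋃ (map ⁅_⁆ h)
    swap : ∀ a b c → a + (b + c) ≡ b + (a + c)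
    swap = solve-∀
    swap′ : ∀ a b c → b + (a + c) ≡ a + b + c
    swap′ = solve-∀
    first : cost x h + ∣ items ∣ * ℓ ≤ reach id x h + ∣ ⁅ x ⁆ Subset.∪ items ∣ * ℓ
    first with x ∈? h
    ... | yes _ = +-monoʳ-≤ (reach id x h) (*-monoˡ-≤ ℓ (Subset.∣q∣≤∣p∪q∣ ⁅ x ⁆ items))
    ... | no x∉h = ≤-trans
      (*-monoˡ-≤ ℓ (Subset.p⊂q⇒∣p∣<∣q∣ (Subset.q⊆p∪q ⁅ x ⁆ items ,
        x , Subset.x∈p∪q⁺ (inj₁ (Subset.x∈⁅x⁆ x)) , x∉h ∘ ∈⋃⁻ h)))
      (m≤n+m _ (reach id x h))

  total≤traffic : ∀ h → total h ≤ traffic id id h + ℓ * ℓ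
  total≤traffic h = ≤-trans (total≤traffic+items h)
    (+-monoʳ-≤ (traffic id id h) (*-monoˡ-≤ ℓ (Subset.∣p∣≤n (⋃ (map ⁅_⁆ h)))))

  traffic-⊆ : ∀ {h h′} → h ⊆ h′ → traffic id id h ≤ traffic id id h′
  traffic-⊆ h⊆h′ = ∑-mono (λ x → ∑-mono (λ y → proj₁ (charge-⊆ x y h⊆h′)))

-- Merges as lists of requests tagged with their sequence

module Tagged (p ℓ : ℕ) where

  open module Item = Recency (Fin._≟_ {ℓ})
    using () renaming (recent to recentᴵ; charge to chargeᴵ; traffic to trafficᴵ) public
  open module Tag = Recency (≡-dec (Fin._≟_ {p}) (Fin._≟_ {ℓ}))
    using (recent; charge; traffic; reach) public

  Request : Set
  Request = Fin p × Fin ℓ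

  thread : Fin p → List Request → Requests ℓ
  thread i []            = []
  thread i ((k , x) ∷ H) = if does (k Fin.≟ i) then x ∷ thread i H else thread i H

  thread-⊆ : ∀ i H → thread i H ⊆ map proj₂ H
  thread-⊆ i [] = []
  thread-⊆ i ((k , x) ∷ H) with k Fin.≟ i
  ... | yes _ = refl ∷ thread-⊆ i H
  ... | no  _ = x ∷ʳ thread-⊆ i H

  -- The steps of a merge recover the tags that its list of requests forgets. `acc` holds the tagged
  -- requests already merged, most recent first, so threads are the sequences reversed.
  merge⇒tagged : ∀ {ss : Vec (Requests ℓ) p} {M} → Merge ss M → ∀ acc → ∃[ H ]
    (map proj₂ H ≡ M ʳ++ map proj₂ acc × ∀ i → thread i H ≡ Vec.lookup ss i ʳ++ thread i acc)
  merge⇒tagged (done empty) acc =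
    acc , refl , λ i → cong (_ʳ++ thread i acc) (sym (empty i))
  merge⇒tagged {ss} (step {x = x} {xs = xs} i ssᵢ merge) acc with merge⇒tagged merge ((i , x) ∷ acc)
  ... | H , items , threads = H , items , λ k → trans (threads k) (stepped k)
    where
    stepped : ∀ k → Vec.lookup (ss Vec.[ i ]≔ xs) k ʳ++ thread k ((i , x) ∷ acc)
              ≡ Vec.lookup ss k ʳ++ thread k acc
    stepped k with i Fin.≟ k
    ... | yes refl rewrite lookup∘update i ss xs | ssᵢ = refl
    ... | no i≢k = cong (_ʳ++ thread k acc) (lookup∘update′ (i≢k ∘ sym) ss xs)

  thread-hit : ∀ i x H → thread i ((i , x) ∷ H) ≡ x ∷ thread i H
  thread-hit i x H with i Fin.≟ i
  ... | yes _ = refl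
  ... | no i≢i = contradiction refl i≢i

  thread-miss : ∀ {i k} x H → k ≢ i → thread i ((k , x) ∷ H) ≡ thread i H
  thread-miss {i} {k} x H k≢i with k Fin.≟ i
  ... | yes k≡i = contradiction k≡i k≢i
  ... | no  _ = refl

  -- Requests with another tag differ from both `(i , x)` and `(i , y)`, so the scan passes over
  -- exactly what `thread` deletes.
  recent-thread : ∀ i x y H → recent (i , x) (i , y) H ≡ recentᴵ x y (thread i H)
  recent-thread i x y [] = go (x Fin.≟ y)
    where
    go : Dec (x ≡ y) → recent (i , x) (i , y) [] ≡ recentᴵ x y []
    go (yes refl) = trans (Tag.recent-refl (i , x) []) (sym (Item.recent-refl x []))
    go (no x≢y)   = trans (Tag.recent-[] {i , x} {i , y} (x≢y ∘ ,-injectiveʳ)) (sym (Item.recent-[] x≢y))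
  recent-thread i x y ((k , z) ∷ H) = go (k Fin.≟ i) (z Fin.≟ y) (z Fin.≟ x)
    where
    go : Dec (k ≡ i) → Dec (z ≡ y) → Dec (z ≡ x) →
         recent (i , x) (i , y) ((k , z) ∷ H) ≡ recentᴵ x y (thread i ((k , z) ∷ H))
    go (no k≢i) _ _
      rewrite thread-miss z H k≢i =
      trans (Tag.recent-skip {i , x} {i , y} {k , z} H (k≢i ∘ ,-injectiveˡ) (k≢i ∘ ,-injectiveˡ))
            (recent-thread i x y H)
    go (yes refl) (yes refl) _
      rewrite thread-hit i z H =
      trans (Tag.recent-hit (i , x) (i , z) H) (sym (Item.recent-hit x z (thread i H)))
    go (yes refl) (no z≢y) (yes refl)
      rewrite thread-hit i z H =
      trans (Tag.recent-stop {i , z} {i , y} H (z≢y ∘ ,-injectiveʳ)) (sym (Item.recent-stop (thread i H) z≢y))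
    go (yes refl) (no z≢y) (no z≢x)
      rewrite thread-hit i z H =
      trans (Tag.recent-skip {i , x} {i , y} {i , z} H (z≢x ∘ ,-injectiveʳ) (z≢y ∘ ,-injectiveʳ))
            (trans (recent-thread i x y H) (sym (Item.recent-skip (thread i H) z≢x z≢y)))

  charge-thread : ∀ i x y H → charge (i , x) (i , y) H ≡ chargeᴵ x y (thread i H)
  charge-thread i x y [] = refl
  charge-thread i x y ((k , z) ∷ H) = go (k Fin.≟ i) (z Fin.≟ x)
    where
    go : Dec (k ≡ i) → Dec (z ≡ x) →
         charge (i , x) (i , y) ((k , z) ∷ H) ≡ chargeᴵ x y (thread i ((k , z) ∷ H))
    go (no k≢i) _
      rewrite thread-miss z H k≢i =
      trans (Tag.charge-miss {i , x} {k , z} (i , y) H (k≢i ∘ ,-injectiveˡ)) (charge-thread i x y H)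
    go (yes refl) (yes refl)
      rewrite thread-hit i z H =
      trans (Tag.charge-hit (i , z) (i , y) H)
            (trans (cong₂ _+_ (recent-thread i z y H) (charge-thread i z y H))
                   (sym (Item.charge-hit z y (thread i H))))
    go (yes refl) (no z≢x)
      rewrite thread-hit i z H =
      trans (Tag.charge-miss {i , x} {i , z} (i , y) H (z≢x ∘ ,-injectiveʳ))
            (trans (charge-thread i x y H) (sym (Item.charge-miss y (thread i H) z≢x)))

  -- The tag of the request to `y` at which the untagged scan stops serves as `k`. The tagged scan
  -- gets at least that far, since copies of `x` with other tags do not stop it.
  recent-untag : ∀ i x y H → ∃[ k ] recentᴵ x y (map proj₂ H) ≤ recent (i , x) (k , y) H
  recent-untag i x y [] = i , ≤-reflexive (sym (recent-thread i x y []))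
  recent-untag i x y ((m , z) ∷ H) = go (z Fin.≟ y) (z Fin.≟ x)
    where
    go : Dec (z ≡ y) → Dec (z ≡ x) →
         ∃[ k ] recentᴵ x y (z ∷ map proj₂ H) ≤ recent (i , x) (k , y) ((m , z) ∷ H)
    go (yes refl) _ = m , ≤-reflexive
      (trans (Item.recent-hit x z (map proj₂ H)) (sym (Tag.recent-hit (i , x) (m , z) H)))
    -- The left side is 0, so the tag `i` is an arbitrary choice.
    go (no z≢y) (yes refl) = i , ≤-trans (≤-reflexive (Item.recent-stop (map proj₂ H) z≢y)) z≤n
    go (no z≢y) (no z≢x) with recent-untag i x y H
    ... | k , r≤ = k , ≤-trans (≤-reflexive (Item.recent-skip (map proj₂ H) z≢x z≢y))
                         (≤-trans r≤ (Tag.recent-cons {i , x} {m , z} (k , y) H (z≢x ∘ ,-injectiveʳ)))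

  -- Every request to `x` belongs to some copy `(m , x)`, and if it is charged for `y`, that copy is
  -- charged for at least one copy of `y`.
  charge-untag : ∀ x y H → chargeᴵ x y (map proj₂ H) ≤ traffic (_, x) (_, y) H
  charge-untag x y [] = z≤n
  charge-untag x y ((m , z) ∷ H) = go (z Fin.≟ x)
    where
    open ≤-Reasoning
    go : Dec (z ≡ x) → chargeᴵ x y (z ∷ map proj₂ H) ≤ traffic (_, x) (_, y) ((m , z) ∷ H)
    go (no z≢x) = begin
      chargeᴵ x y (z ∷ map proj₂ H)             ≡⟨ Item.charge-miss y (map proj₂ H) z≢x ⟩
      chargeᴵ x y (map proj₂ H)                 ≤⟨ charge-untag x y H ⟩
      traffic (_, x) (_, y) H                   ≡⟨ Tag.traffic-miss (_, x) (_, y) {m , z} H (λ i → z≢x ∘ ,-injectiveʳ) ⟨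
      traffic (_, x) (_, y) ((m , z) ∷ H)       ∎
    go (yes refl) with recent-untag m x y H
    ... | k , r≤ = begin
      chargeᴵ x y (x ∷ map proj₂ H)
        ≡⟨ Item.charge-hit x y (map proj₂ H) ⟩
      recentᴵ x y (map proj₂ H) + chargeᴵ x y (map proj₂ H)
        ≤⟨ +-mono-≤ (≤-trans r≤ (term≤∑ (λ k → recent (m , x) (k , y) H) k)) (charge-untag x y H) ⟩
      reach (_, y) (m , x) H + traffic (_, x) (_, y) H
        ≡⟨ Tag.traffic-hit (_, x) (_, y) ,-injectiveˡ m H ⟨
      traffic (_, x) (_, y) ((m , x) ∷ H) ∎

  traffic-untag : ∀ H →
    trafficᴵ id id (map proj₂ H) ≤ ∑[ i < p ] ∑[ k < p ] traffic (i ,_) (k ,_) H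
  traffic-untag H = begin
    trafficᴵ id id (map proj₂ H)
      ≤⟨ ∑-mono (λ x → ∑-mono (λ y → charge-untag x y H)) ⟩
    ∑[ x < ℓ ] ∑[ y < ℓ ] ∑[ i < p ] ∑[ k < p ] charge (i , x) (k , y) H
      ≡⟨ sum-cong-≗ (λ x → ∑-comm {ℓ} {p} (λ y i → ∑[ k < p ] charge (i , x) (k , y) H)) ⟩
    ∑[ x < ℓ ] ∑[ i < p ] ∑[ y < ℓ ] ∑[ k < p ] charge (i , x) (k , y) H
      ≡⟨ ∑-comm {ℓ} {p} (λ x i → ∑[ y < ℓ ] ∑[ k < p ] charge (i , x) (k , y) H) ⟩
    ∑[ i < p ] ∑[ x < ℓ ] ∑[ y < ℓ ] ∑[ k < p ] charge (i , x) (k , y) H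
      ≡⟨ sum-cong-≗ (λ i → sum-cong-≗ (λ x →
           ∑-comm {ℓ} {p} (λ y k → charge (i , x) (k , y) H))) ⟩
    ∑[ i < p ] ∑[ x < ℓ ] ∑[ k < p ] ∑[ y < ℓ ] charge (i , x) (k , y) H
      ≡⟨ sum-cong-≗ (λ i → ∑-comm {ℓ} {p} (λ x k → ∑[ y < ℓ ] charge (i , x) (k , y) H)) ⟩
    ∑[ i < p ] ∑[ k < p ] traffic (i ,_) (k ,_) H ∎
    where open ≤-Reasoning

  -- Summing over ordered pairs of sequences

  module _ (H : List Request) (W : ℕ) (thread≤W : ∀ i → trafficᴵ id id (thread i H) ≤ W) where

    diagonal≤ : ∀ i → traffic (i ,_) (i ,_) H ≤ W
    diagonal≤ i = ≤-trans
      (≤-reflexive (sum-cong-≗ (λ x → sum-cong-≗ (λ y → charge-thread i x y H)))) (thread≤W i)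

    -- The extra W for k = i brings 2p W down to (2p − 1) W when summed over k.
    pair≤ : ∀ i k → (if does (k Fin.≟ i) then W else 0) + traffic (i ,_) (k ,_) H ≤ ℓ * ℓ + (W + W)
    pair≤ i k with k Fin.≟ i
    ... | yes refl = ≤-trans (+-monoʳ-≤ W (diagonal≤ i)) (m≤n+m _ (ℓ * ℓ))
    ... | no k≢i = ≤-trans (traffic≤ H)
      (+-mono-≤ (potential≤ H) (+-mono-≤ (diagonal≤ i) (diagonal≤ k)))
      where open Tag.Crossing (i ,_) (k ,_) ,-injectiveʳ ,-injectiveʳ (λ x y → k≢i ∘ sym ∘ ,-injectiveˡ)

    row≤ : ∀ i → W + ∑[ k < p ] traffic (i ,_) (k ,_) H ≤ p * (ℓ * ℓ + (W + W))
    row≤ i = begin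
      W + ∑[ k < p ] traffic (i ,_) (k ,_) H
        ≡⟨ cong (_+ ∑[ k < p ] traffic (i ,_) (k ,_) H) (∑-indicator i W) ⟨
      ∑[ k < p ] δ k + ∑[ k < p ] traffic (i ,_) (k ,_) H
        ≡⟨ ∑-distrib-+ δ _ ⟨
      ∑[ k < p ] (δ k + traffic (i ,_) (k ,_) H)
        ≤⟨ ∑-mono (pair≤ i) ⟩
      ∑[ k < p ] (ℓ * ℓ + (W + W))
        ≡⟨ ∑-const p _ ⟩
      p * (ℓ * ℓ + (W + W)) ∎
      where
      open ≤-Reasoning
      δ : Fin p → ℕ
      δ k = if does (k Fin.≟ i) then W else 0

theorem15 : ∀ (p ℓ : ℕ) → 1 ≤ p → 1 ≤ ℓ →
    ∃[ c ] (∀ (ss : Vec (Requests ℓ) p) (M₁ M₂ : Requests ℓ) →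
    Merge ss M₁ → Merge ss M₂ →
    totalDistance M₁ ≤ (2 * p ^ 2 ∸ p) * totalDistance M₂ + c)
-- One `ℓ * ℓ` bounds the potential of each ordered pair of sequences; the last one covers the first
-- requests in `M₁`.
theorem15 p@(suc q) ℓ _ _ = p * (p * (ℓ * ℓ)) + ℓ * ℓ , bound
  where
  open Tagged p ℓ
  open ≤-Reasoning

  -- With p = q + 1 the factor 2p - 1 is `suc (2 * q)`, and the truncated subtraction is exact.
  coefficient : 2 * p ^ 2 ∸ p ≡ p * suc (2 * q)
  coefficient = trans (cong (_∸ p) (expand q)) (m+n∸n≡m (p * suc (2 * q)) p)
    where
    expand : ∀ q → 2 * (suc q * (suc q * 1)) ≡ suc q * suc (2 * q) + suc q
    expand = solve-∀

  split : ∀ q W L → suc q * (L + (W + W)) ≡ W + (suc (2 * q) * W + suc q * L)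
  split = solve-∀

  collect : ∀ a b W L c → a * (b * W + L) + c ≡ a * b * W + (a * L + c)
  collect = solve-∀

  bound : ∀ (ss : Vec (Requests ℓ) p) (M₁ M₂ : Requests ℓ) → Merge ss M₁ → Merge ss M₂ →
          totalDistance M₁ ≤ (2 * p ^ 2 ∸ p) * totalDistance M₂ + (p * (p * (ℓ * ℓ)) + ℓ * ℓ)
  bound ss M₁ M₂ merge₁ merge₂ with merge⇒tagged merge₁ [] | merge⇒tagged merge₂ []
  ... | H₁ , items₁ , threads₁ | H₂ , items₂ , threads₂ = begin
    totalDistance M₁
      ≡⟨ totalDistance≡total M₁ ⟩
    total (M₁ ʳ++ [])
      ≤⟨ total≤traffic (M₁ ʳ++ []) ⟩
    trafficᴵ id id (M₁ ʳ++ []) + ℓ * ℓ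
      ≡⟨ cong (λ h → trafficᴵ id id h + ℓ * ℓ) items₁ ⟨
    trafficᴵ id id (map proj₂ H₁) + ℓ * ℓ
      ≤⟨ +-monoˡ-≤ (ℓ * ℓ) (traffic-untag H₁) ⟩
    ∑[ i < p ] ∑[ k < p ] traffic (i ,_) (k ,_) H₁ + ℓ * ℓ
      -- Cancelling the extra `W` of each row leaves 2p - 1 copies of `W`.
      ≤⟨ +-monoˡ-≤ (ℓ * ℓ) (∑-mono (λ i → +-cancelˡ-≤ W _ _
           (≤-trans (row≤ H₁ W thread≤W i) (≤-reflexive (split q W (ℓ * ℓ)))))) ⟩
    ∑[ i < p ] (suc (2 * q) * W + p * (ℓ * ℓ)) + ℓ * ℓ
      ≡⟨ cong (_+ ℓ * ℓ) (∑-const p _) ⟩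
    p * (suc (2 * q) * W + p * (ℓ * ℓ)) + ℓ * ℓ
      ≡⟨ collect p (suc (2 * q)) W (p * (ℓ * ℓ)) (ℓ * ℓ) ⟩
    p * suc (2 * q) * W + c
      ≡⟨ cong (λ a → a * W + c) coefficient ⟨
    (2 * p ^ 2 ∸ p) * W + c
      ≡⟨ cong (λ d → (2 * p ^ 2 ∸ p) * d + c) (totalDistance≡total M₂) ⟨
    (2 * p ^ 2 ∸ p) * totalDistance M₂ + c ∎
    where
    c = p * (p * (ℓ * ℓ)) + ℓ * ℓ
    W = total (M₂ ʳ++ [])
    -- Both merges have the same threads, so the charges within a sequence of `M₁` can be bounded in
    -- `M₂`, of which it is a subsequence.
    thread≤W : ∀ i → trafficᴵ id id (thread i H₁) ≤ W
    thread≤W i = begin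
      trafficᴵ id id (thread i H₁)
        ≡⟨ cong (trafficᴵ id id) (trans (threads₁ i) (sym (threads₂ i))) ⟩
      trafficᴵ id id (thread i H₂)
        ≤⟨ traffic-⊆ (thread-⊆ i H₂) ⟩
      trafficᴵ id id (map proj₂ H₂)
        ≡⟨ cong (trafficᴵ id id) items₂ ⟩
      trafficᴵ id id (M₂ ʳ++ [])
        ≤⟨ traffic≤total (M₂ ʳ++ []) ⟩
      total (M₂ ʳ++ []) ∎
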